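{- Let $s,t\geq 1$ be integers. Every $K_{s,t}$-subgraph-free graph $G$ is $s$-colourable with defect at most $$\mathrm{col}_2(G)+(t-1)\binom{\mathrm{col}_2(G)}{s-1}.$$
   Context: Graphs are finite, simple and undirected. A graph is $K_{s,t}$-subgraph-free if it has no (not necessarily induced) subgraph isomorphic to the complete bipartite graph $K_{s,t}$. An $s$-colouring assigns one of at most $s$ colours to each vertex (not necessarily properly). A monochromatic component is a connected component of the subgraph induced by all vertices of a single colour. A colouring has defect $d$ if every monochromatic component has maximum degree at most $d$. For a graph $G$, a total order $\preceq$ of $V(G)$, and a positive integer $r$, a vertex $w$ is $r$-reachable from a vertex $v$ if there is a path $v=w_0,w_1,\dots,w_{r'}=w$ in $G$ of length $r'$ with $0\leq r'\leq r$ such that $w\preceq v$ and $v\prec w_i$ for all $i\in\{1,\dots,r'-1\}$ (so $v$ is $r$-reachable from itself). The $r$-strong colouring number $\mathrm{col}_r(G)$ is the minimum integer such that there is a total order $\preceq$ of $V(G)$ for which at most $\mathrm{col}_r(G)$ vertices are $r$-reachable from each vertex of $G$. -}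

module Defs where

open import Data.Empty using (⊥)
import Data.Fin as Fin
open import Data.Fin using (Fin; zero; suc; toℕ; inject₁)
open import Data.Fin.Properties using (_≟_; any?; all?; ≤-isTotalOrder)
open import Data.Fin.Subset using (Subset; _∈_; _∩_; ∣_∣) renaming (⊤ to full)
open import Data.Fin.Subset.Properties using (_∈?_; anySubset?; ∈⊤; ∣p∣≤n)
open import Data.Nat using (ℕ; zero; suc; _≤_; _<_; _≤?_; _<?_)
open import Data.Nat.Properties using (anyUpTo?; ≮⇒≥)
open import Data.Nat.Induction using (<-rec)
open import Data.Product using (Σ; ∃; ∃-syntax; _×_; _,_; proj₁; proj₂)
open import Data.Sum using (_⊎_; inj₁; inj₂)
import Data.Sum as Sum
open import Data.Unit using (⊤)
open import Data.Vec using (Vec; []; _∷_; lookup; tabulate; head; last)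
open import Data.Vec.Properties using (lookup∘tabulate; []=⇒lookup; lookup⇒[]=)
open import Data.Vec.Relation.Unary.Unique.Propositional using (Unique)
import Data.Vec.Relation.Unary.AllPairs as AllPairs
open import Function using (_∘_; _⇔_; Injective)
open import Level using (0ℓ)
open import Relation.Binary using (Rel; Symmetric; Irreflexive; Decidable; IsTotalOrder; _⇒_)
open import Relation.Binary.Construct.Closure.ReflexiveTransitive using (Star)
import Relation.Binary.Construct.NonStrictToStrict as Strict
open import Relation.Binary.Consequences using (total∧dec⇒dec)
open import Relation.Binary.PropositionalEquality
  using (_≡_; refl; sym; trans; isEquivalence)
open import Relation.Nullary using (¬_; Dec; yes; no; does; ¬?; _×-dec_; _→-dec_; _⊎-dec_)
open import Relation.Nullary.Decidable using (map′; dec-true)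
open import Relation.Unary using (Pred) renaming (Decidable to Decidable₁)

record Graph (V : Set) : Set₁ where
  infix 4 _~_ _~?_
  field
    _~_    : Rel V 0ℓ
    _~?_   : Decidable _~_
    ~-sym  : Symmetric _~_
    ~-irr  : Irreflexive _≡_ _~_

-- Finite graphs are taken to have vertex set Fin n.
FinGraph : ℕ → Set₁
FinGraph n = Graph (Fin n)

K : (s t : ℕ) → Graph (Fin s ⊎ Fin t)
K s t = record { _~_ = _~_ ; _~?_ = _~?_ ; ~-sym = λ {x} {y} → ~-sym {x} {y} ; ~-irr = ~-irr }
  where
  _~_ : Rel (Fin s ⊎ Fin t) 0ℓ
  inj₁ _ ~ inj₁ _ = ⊥
  inj₁ _ ~ inj₂ _ = ⊤
  inj₂ _ ~ inj₁ _ = ⊤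
  inj₂ _ ~ inj₂ _ = ⊥

  _~?_ : Decidable _~_
  inj₁ _ ~? inj₁ _ = no λ ()
  inj₁ _ ~? inj₂ _ = yes _
  inj₂ _ ~? inj₁ _ = yes _
  inj₂ _ ~? inj₂ _ = no λ ()

  ~-sym : Symmetric _~_
  ~-sym {inj₁ _} {inj₂ _} _ = _
  ~-sym {inj₂ _} {inj₁ _} _ = _

  ~-irr : Irreflexive _≡_ _~_
  ~-irr {inj₁ _} refl ()
  ~-irr {inj₂ _} refl ()

-- H is isomorphic to a (not necessarily induced) subgraph of G.
record _⊑_ {W V : Set} (H : Graph W) (G : Graph V) : Set where
  private
    module H = Graph H
    module G = Graph G
  field
    embed     : W → V
    injective : Injective _≡_ _≡_ embed
    preserves : ∀ {x y} → x H.~ y → embed x G.~ embed y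

SubgraphFree : {W V : Set} → Graph W → Graph V → Set
SubgraphFree H G = ¬ (H ⊑ G)

module _ {n : ℕ} (G : FinGraph n) where
  open Graph G

  InducedAdj : Subset n → Rel (Fin n) 0ℓ
  InducedAdj S u v = u ∈ S × v ∈ S × u ~ v

  -- C is the vertex set of a connected component of G[S].
  IsComponent : Subset n → Subset n → Set
  IsComponent S C = ∃[ v ] v ∈ S × (∀ u → u ∈ C ⇔ Star (InducedAdj S) v u)

  neighbours : Fin n → Subset n
  neighbours v = tabulate (λ u → does (v ~? u))

  degreeIn : Subset n → Fin n → ℕ
  degreeIn C v = ∣ neighbours v ∩ C ∣

  -- The maximum degree of G[C] is at most d.
  MaxDegree≤ : Subset n → ℕ → Set
  MaxDegree≤ C d = ∀ v → v ∈ C → degreeIn C v ≤ d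

Colouring : ℕ → ℕ → Set
Colouring n s = Fin n → Fin s

colourClass : ∀ {n s} → Colouring n s → Fin s → Subset n
colourClass c i = tabulate (λ v → does (c v ≟ i))

-- A component of G[S] is an induced subgraph of G[S], and hence of G, so its
-- degrees are those of G[C].
HasDefect : ∀ {n s} → FinGraph n → Colouring n s → ℕ → Set
HasDefect G c d = ∀ i C → IsComponent G (colourClass c i) C → MaxDegree≤ G C d

-- At most k elements of Fin n satisfy P.
AtMost : ∀ {n} → ℕ → Pred (Fin n) 0ℓ → Set
AtMost {n} k P = ∃[ S ] ∣ S ∣ ≤ k × (∀ w → P w → w ∈ S)

module _ {n : ℕ} (G : FinGraph n) where
  open Graph G

  IsPath : ∀ {l} → Vec (Fin n) (suc l) → Set
  IsPath {l} p = Unique p × (∀ (i : Fin l) → lookup p (inject₁ i) ~ lookup p (suc i))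

  -- Reachable _≼_ r v w : w is r-reachable from v.
  Reachable : Rel (Fin n) 0ℓ → ℕ → Rel (Fin n) 0ℓ
  Reachable _≼_ r v w =
    w ≼ v ×
    ∃[ l ] l < suc r × Σ (Vec (Fin n) (suc l)) λ p →
      IsPath p × head p ≡ v × last p ≡ w ×
      (∀ i → 0 < toℕ i → toℕ i < l → v ≺ lookup p i)
    where open Strict _≡_ _≼_ renaming (_<_ to _≺_)

  HasOrder : ℕ → ℕ → Set₁
  HasOrder r k = Σ (Rel (Fin n) 0ℓ) λ _≼_ →
    IsTotalOrder _≡_ _≼_ × (∀ v → AtMost k (Reachable _≼_ r v))

  IsColouringNumber : ℕ → ℕ → Set₁
  IsColouringNumber r k = HasOrder r k × (∀ m → HasOrder r m → k ≤ m)

-- The strong colouring number exists: total orders on Fin n can be encoded as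
-- Boolean matrices, so HasOrder is decidable and a least k can be searched for.
private
  Search : Set → Set₁
  Search A = {P : Pred A 0ℓ} → Decidable₁ P → Dec (∃ P)

  searchVec : ∀ {A} → Search A → ∀ m → Search (Vec A m)
  searchVec search zero P? = map′ (λ q → [] , q) (λ { ([] , q) → q }) (P? [])
  searchVec search (suc m) P? =
    map′ (λ { (x , xs , q) → x ∷ xs , q }) (λ { (x ∷ xs , q) → x , xs , q })
         (search λ x → searchVec search m λ xs → P? (x ∷ xs))

  least : ∀ {ℓ} {P : Pred ℕ ℓ} → Decidable₁ P → ∀ k → P k → ∃[ m ] P m × (∀ j → P j → m ≤ j)
  least {P = P} P? = <-rec _ step
    where
    step : ∀ k → (∀ {j} → j < k → P j → ∃[ m ] P m × (∀ j → P j → m ≤ j)) →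
           P k → ∃[ m ] P m × (∀ j → P j → m ≤ j)
    step k rec pk with anyUpTo? P? k
    ... | yes (j , j<k , pj) = rec j<k pj
    ... | no ¬smaller = k , pk , λ j pj → ≮⇒≥ λ j<k → ¬smaller (j , j<k , pj)

  module _ {n : ℕ} where
    atMost? : ∀ k {P : Pred (Fin n) 0ℓ} → Decidable₁ P → Dec (AtMost k P)
    atMost? k P? = anySubset? λ S → (∣ S ∣ ≤? k) ×-dec all? λ w → P? w →-dec (w ∈? S)

    isTotalOrder? : {_≼_ : Rel (Fin n) 0ℓ} → Decidable _≼_ → Dec (IsTotalOrder _≡_ _≼_)
    isTotalOrder? {_≼_} _≼?_ = map′ to from
      ( all? (λ x → x ≼? x)
      ×-dec all? (λ x → all? λ y → (x ≼? y) →-dec ((y ≼? x) →-dec (x ≟ y)))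
      ×-dec all? (λ x → all? λ y → all? λ z → (x ≼? y) →-dec ((y ≼? z) →-dec (x ≼? z)))
      ×-dec all? (λ x → all? λ y → (x ≼? y) ⊎-dec (y ≼? x)))
      where
      Laws : Set
      Laws = (∀ x → x ≼ x) × (∀ x y → x ≼ y → y ≼ x → x ≡ y)
           × (∀ x y z → x ≼ y → y ≼ z → x ≼ z) × (∀ x y → x ≼ y ⊎ y ≼ x)
      to : Laws → IsTotalOrder _≡_ _≼_
      to (rf , as , tr , tt) = record
        { isPartialOrder = record
          { isPreorder = record
            { isEquivalence = isEquivalence
            ; reflexive = λ { refl → rf _ }
            ; trans = tr _ _ _ }
          ; antisym = as _ _ }
        ; total = tt }
      from : IsTotalOrder _≡_ _≼_ → Laws
      from o = (λ _ → O.refl) , (λ _ _ → O.antisym) , (λ _ _ _ → O.trans) , O.total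
        where module O = IsTotalOrder o

    transfer : {_≼_ _≼′_ : Rel (Fin n) 0ℓ} → _≼_ ⇒ _≼′_ → _≼′_ ⇒ _≼_ →
               IsTotalOrder _≡_ _≼_ → IsTotalOrder _≡_ _≼′_
    transfer f g o = record
      { isPartialOrder = record
        { isPreorder = record
          { isEquivalence = isEquivalence
          ; reflexive = f ∘ O.reflexive
          ; trans = λ p q → f (O.trans (g p) (g q)) }
        ; antisym = λ p q → O.antisym (g p) (g q) }
      ; total = λ x y → Sum.map f f (O.total x y) }
      where
      module O = IsTotalOrder o

    decode : Vec (Subset n) n → Rel (Fin n) 0ℓ
    decode M x y = y ∈ lookup M x

    encode : {_≼_ : Rel (Fin n) 0ℓ} → Decidable _≼_ → Vec (Subset n) n
    encode _≼?_ = tabulate λ x → tabulate λ y → does (x ≼? y)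

    module _ {_≼_ : Rel (Fin n) 0ℓ} (_≼?_ : Decidable _≼_) where
      decode-encode⁺ : _≼_ ⇒ decode (encode _≼?_)
      decode-encode⁺ {x} {y} p
        rewrite lookup∘tabulate (λ x → tabulate λ y → does (x ≼? y)) x =
        lookup⇒[]= y _ (trans (lookup∘tabulate (λ y → does (x ≼? y)) y) (dec-true (x ≼? y) p))

      decode-encode⁻ : decode (encode _≼?_) ⇒ _≼_
      decode-encode⁻ {x} {y} p
        rewrite lookup∘tabulate (λ x → tabulate λ y → does (x ≼? y)) x
        with x ≼? y | trans (sym (lookup∘tabulate (λ y → does (x ≼? y)) y)) ([]=⇒lookup p)
      ... | yes q | _  = q
      ... | no _  | ()

  module _ {n : ℕ} (G : FinGraph n) where
    open Graph G

    reachable? : {_≼_ : Rel (Fin n) 0ℓ} → Decidable _≼_ → ∀ r → Decidable (Reachable G _≼_ r)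
    reachable? _≼?_ r v w = (w ≼? v) ×-dec anyUpTo? (λ l → searchVec any? (suc l) λ p →
        (AllPairs.allPairs? (λ x y → ¬? (x ≟ y)) p ×-dec all? (λ i → lookup p (inject₁ i) ~? lookup p (suc i)))
        ×-dec (head p ≟ v) ×-dec (last p ≟ w)
        ×-dec all? (λ i → (0 <? toℕ i) →-dec ((toℕ i <? l) →-dec
                ((v ≼? lookup p i) ×-dec ¬? (v ≟ lookup p i))))) (suc r)

    reachable-mono : {_≼_ _≼′_ : Rel (Fin n) 0ℓ} → _≼_ ⇒ _≼′_ →
                     ∀ r → Reachable G _≼_ r ⇒ Reachable G _≼′_ r
    reachable-mono f r (w≼v , l , l≤r , p , path , h , e , int) =
      f w≼v , l , l≤r , p , path , h , e ,
      λ i 0<i i<l → f (proj₁ (int i 0<i i<l)) , proj₂ (int i 0<i i<l)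

    hasOrder? : ∀ r → Decidable₁ (HasOrder G r)
    hasOrder? r k = map′ to from (searchVec anySubset? n λ M →
        isTotalOrder? (decode? M) ×-dec all? λ v → atMost? k (reachable? (decode? M) r v))
      where
      decode? : ∀ M → Decidable (decode M)
      decode? M x y = y ∈? lookup M x

      Good : Rel (Fin n) 0ℓ → Set
      Good _≼_ = IsTotalOrder _≡_ _≼_ × (∀ v → AtMost k (Reachable G _≼_ r v))

      to : ∃ (Good ∘ decode) → HasOrder G r k
      to (M , good) = decode M , good

      from : HasOrder G r k → ∃ (Good ∘ decode)
      from (_≼_ , o , bound) = encode _≼?_ ,
        transfer (decode-encode⁺ _≼?_) (decode-encode⁻ _≼?_) o ,
        λ v → let (S , small , cover) = bound v in
          S , small , λ w → cover w ∘ reachable-mono (decode-encode⁻ _≼?_) r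
        where
        module O = IsTotalOrder o
        _≼?_ : Decidable _≼_
        _≼?_ = total∧dec⇒dec O.reflexive O.antisym O.total _≟_

abstract
  col-exists : ∀ {n} r (G : FinGraph n) → ∃ (IsColouringNumber G r)
  col-exists {n} r G = least (hasOrder? G r) n
    (Fin._≤_ , ≤-isTotalOrder , λ _ → full , ∣p∣≤n full , λ _ _ → ∈⊤)

-- The r-strong colouring number of G, characterised by proj₂ (col-exists r G).
col : ∀ {n} → ℕ → FinGraph n → ℕ
col r G = proj₁ (col-exists r G)

{-# OPTIONS --safe #-}

-- Fix an order ≼ witnessing col₂ and colour greedily along it: a vertex w avoids
-- the colours of its first s ∸ 1 left-neighbours. If v ≺ w are adjacent and
-- share a colour, then w has at least s ∸ 1 neighbours before v, all of them
-- 2-reachable from v through w. An (s ∸ 1)-set of vertices together with v has at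
-- most t ∸ 1 common neighbours, so v has at most (t ∸ 1) * (col₂ C (s ∸ 1)) such
-- right-neighbours w; its left-neighbours are themselves 2-reachable from v.
module Submission where

open import Defs
open import Data.Fin using (Fin; zero; suc; toℕ; fromℕ<; inject≤)
open import Data.Fin.Properties
  using (_≟_; any?; ¬∀⟶∃¬; pigeonhole; suc-injective; toℕ-fromℕ<; <⇒≢; inject≤-injective)
open import Data.Fin.Subset
  using (Subset; inside; outside; _∈_; _⊆_; _∪_; _∩_; ⁅_⁆; ∣_∣)
  renaming (⊥ to ∅)
open import Data.Fin.Subset.Properties
  using (_∈?_; drop-there; s⊆s; out⊆; ∣⊥∣≡0; ⊥⊆; x∈⁅x⁆; x∈⁅y⁆⇒x≡y;
         p⊆q⇒∣p∣≤∣q∣; p⊂q⇒∣p∣<∣q∣; ∣p∣≤n; x∈p∩q⁻; p⊆p∪q; q⊆p∪q; x∈p∪q⁻; x∈p∪q⁺)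
open import Data.Nat using (ℕ; zero; suc; _+_; _*_; _∸_; _≤_; _<_; _<?_; _≤?_; z≤n; s≤s)
import Data.Nat as ℕ
open import Data.Nat.Combinatorics using (_C_; nCk+nC[k+1]≡[n+1]C[k+1])
import Data.Nat.Properties as ℕ
open import Data.Product using (Σ; ∃; ∃-syntax; _×_; _,_; proj₁; proj₂)
open import Data.Sum using (inj₁; inj₂; [_,_]′)
open import Data.Unit using (⊤)
open import Data.Vec using ([]; _∷_; tabulate; tail; here; there)
open import Data.Vec.Properties using (lookup∘tabulate; []=⇒lookup; lookup⇒[]=)
import Data.Vec.Relation.Unary.All as All
import Data.Vec.Relation.Unary.AllPairs as AllPairs
open import Function using (_∘_; Equivalence; Injective)
open import Level using (0ℓ)
open import Relation.Binary using (Rel; Decidable; IsTotalOrder; tri<; tri≈; tri>)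
open import Relation.Binary.Construct.Closure.ReflexiveTransitive using (Star; ε; _◅_)
import Relation.Binary.Construct.NonStrictToStrict as Strict
open import Relation.Binary.Consequences using (total∧dec⇒dec)
open import Relation.Binary.PropositionalEquality
  using (_≡_; _≢_; refl; sym; trans; cong; subst)
open import Relation.Nullary using (¬_; yes; no; does; _×-dec_; contradiction)
open import Relation.Nullary.Decidable using (dec-true)
open import Relation.Unary using (Pred) renaming (Decidable to Decidable₁)

private
  variable
    m n r : ℕ

-- Finite subsets and their cardinalities.

sieve : {P : Pred (Fin n) 0ℓ} → Decidable₁ P → Subset n
sieve P? = tabulate (λ u → does (P? u))

module _ {P : Pred (Fin n) 0ℓ} (P? : Decidable₁ P) where
  ∈-sieve⁺ : ∀ {u} → P u → u ∈ sieve P?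
  ∈-sieve⁺ {u} pu =
    lookup⇒[]= u _ (trans (lookup∘tabulate (λ x → does (P? x)) u) (dec-true (P? u) pu))

  ∈-sieve⁻ : ∀ {u} → u ∈ sieve P? → P u
  ∈-sieve⁻ {u} u∈
    with P? u | trans (sym (lookup∘tabulate (λ x → does (P? x)) u)) ([]=⇒lookup u∈)
  ... | yes pu | _  = pu
  ... | no  _  | ()

∣p∪q∣≤∣p∣+∣q∣ : (p q : Subset n) → ∣ p ∪ q ∣ ≤ ∣ p ∣ + ∣ q ∣
∣p∪q∣≤∣p∣+∣q∣ []            []            = z≤n
∣p∪q∣≤∣p∣+∣q∣ (outside ∷ p) (outside ∷ q) = ∣p∪q∣≤∣p∣+∣q∣ p q
∣p∪q∣≤∣p∣+∣q∣ (outside ∷ p) (inside  ∷ q) =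
  ℕ.≤-trans (s≤s (∣p∪q∣≤∣p∣+∣q∣ p q)) (ℕ.≤-reflexive (sym (ℕ.+-suc ∣ p ∣ ∣ q ∣)))
∣p∪q∣≤∣p∣+∣q∣ (inside  ∷ p) (outside ∷ q) = s≤s (∣p∪q∣≤∣p∣+∣q∣ p q)
∣p∪q∣≤∣p∣+∣q∣ (inside  ∷ p) (inside  ∷ q) =
  s≤s (ℕ.≤-trans (∣p∪q∣≤∣p∣+∣q∣ p q) (ℕ.+-monoʳ-≤ ∣ p ∣ (ℕ.n≤1+n ∣ q ∣)))

enumerate : (p : Subset n) →
  Σ (Fin ∣ p ∣ → Fin n) λ f → Injective _≡_ _≡_ f × (∀ i → f i ∈ p)
enumerate []            = (λ ()) , (λ { {()} }) , λ ()
enumerate (outside ∷ p) with enumerate p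
... | f , f-inj , f∈p = suc ∘ f , f-inj ∘ suc-injective , there ∘ f∈p
enumerate {suc n} (inside ∷ p) with enumerate p
... | f , f-inj , f∈p = g , g-inj , g∈p
  where
  g : Fin (suc ∣ p ∣) → Fin (suc n)
  g zero    = zero
  g (suc i) = suc (f i)

  g-inj : Injective _≡_ _≡_ g
  g-inj {zero}  {zero}  _  = refl
  g-inj {suc _} {suc _} eq = cong suc (f-inj (suc-injective eq))

  g∈p : ∀ i → g i ∈ inside ∷ p
  g∈p zero    = here
  g∈p (suc i) = there (f∈p i)

choose : (p : Subset n) → m ≤ ∣ p ∣ →
  Σ (Fin m → Fin n) λ f → Injective _≡_ _≡_ f × (∀ i → f i ∈ p)
choose p m≤p with enumerate p
... | f , f-inj , f∈p =
  (λ i → f (inject≤ i m≤p)) , inject≤-injective m≤p m≤p _ _ ∘ f-inj , λ i → f∈p (inject≤ i m≤p)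

-- Counting by deletion of one point.

∈-tail⁻ : (p : Subset (suc n)) → ∀ {x} → x ∈ tail p → suc x ∈ p
∈-tail⁻ (_ ∷ _) = there

tail-⊆ : ∀ {b} (p : Subset (suc n)) {q : Subset n} → p ⊆ b ∷ q → tail p ⊆ q
tail-⊆ p p⊆q = drop-there ∘ p⊆q ∘ ∈-tail⁻ p

∣p∣≤1+∣tail∣ : (p : Subset (suc n)) → ∣ p ∣ ≤ suc ∣ tail p ∣
∣p∣≤1+∣tail∣ (outside ∷ p) = ℕ.n≤1+n ∣ p ∣
∣p∣≤1+∣tail∣ (inside  ∷ p) = ℕ.≤-refl

∣p∣≤∣tail∣ : (p : Subset (suc n)) → ¬ (zero ∈ p) → ∣ p ∣ ≤ ∣ tail p ∣
∣p∣≤∣tail∣ (outside ∷ p) _   = ℕ.≤-refl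
∣p∣≤∣tail∣ (inside  ∷ p) 0∉p = contradiction here 0∉p

out∷-⊆ : (p : Subset n) (q : Subset (suc n)) → p ⊆ tail q → outside ∷ p ⊆ q
out∷-⊆ p (_ ∷ _) = out⊆

in∷-⊆ : (p : Subset n) (q : Subset (suc n)) → zero ∈ q → p ⊆ tail q → inside ∷ p ⊆ q
in∷-⊆ p (.inside ∷ _) here = s⊆s

-- Double counting of the pairs (w , T) with w ∈ B, T ⊆ F w and |T| = m. The
-- induction deletes one point of R at a time, so the count follows Pascal's rule.
double-counting : (R : Subset r) (m k q : ℕ) (B : Subset n) (F : Fin n → Subset r) →
  ∣ R ∣ ≤ k →
  (∀ {w} → w ∈ B → F w ⊆ R) →
  (∀ {w} → w ∈ B → m ≤ ∣ F w ∣) →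
  (∀ T D → ∣ T ∣ ≡ m → D ⊆ B → (∀ {w} → w ∈ D → T ⊆ F w) → ∣ D ∣ ≤ q) →
  ∣ B ∣ ≤ q * (k C m)
-- For `m = 0` the only set to count is `∅`, with `D = B`, and `k C 0` is 1.
double-counting {r = r} R zero k q B F R≤k F⊆R m≤F few =
  ℕ.≤-trans (few ∅ B (∣⊥∣≡0 r) (λ x → x) (λ _ → ⊥⊆)) (ℕ.≤-reflexive (sym (ℕ.*-identityʳ q)))
-- Over an empty ground set no `F w` has `suc m` elements, so `B` is empty.
double-counting {n = n} [] (suc m) k q B F R≤k F⊆R m≤F few =
  subst (_≤ q * (k C suc m)) (sym ∣B∣≡0) z≤n
  where
  empty : (p : Subset 0) → ¬ (suc m ≤ ∣ p ∣)
  empty [] ()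
  ∣B∣≡0 : ∣ B ∣ ≡ 0
  ∣B∣≡0 = ℕ.n≤0⇒n≡0 (subst (∣ B ∣ ≤_) (∣⊥∣≡0 n)
    (p⊆q⇒∣p∣≤∣q∣ {p = B} {q = ∅} λ {w} w∈B → contradiction (m≤F w∈B) (empty (F w))))
double-counting (outside ∷ R) (suc m) k q B F R≤k F⊆R m≤F few =
  double-counting R (suc m) k q B (tail ∘ F) R≤k
    (λ {w} w∈B → tail-⊆ (F w) (F⊆R w∈B))
    (λ {w} w∈B → ℕ.≤-trans (m≤F w∈B) (∣p∣≤∣tail∣ (F w) λ 0∈ → contradiction (F⊆R w∈B 0∈) λ ()))
    (λ T D ∣T∣ D⊆B T⊆ → few (outside ∷ T) D ∣T∣ D⊆B λ {w} w∈D → out∷-⊆ T (F w) (T⊆ w∈D))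
double-counting {n = n} (inside ∷ R) (suc m) (suc k) q B F (s≤s R≤k) F⊆R m≤F few = begin
  ∣ B ∣                               ≤⟨ p⊆q⇒∣p∣≤∣q∣ B⊆ ⟩
  ∣ with0 ∪ without0 ∣                ≤⟨ ∣p∪q∣≤∣p∣+∣q∣ with0 without0 ⟩
  ∣ with0 ∣ + ∣ without0 ∣            ≤⟨ ℕ.+-mono-≤ bound-with bound-without ⟩
  q * (k C m) + q * (k C suc m)       ≡⟨ ℕ.*-distribˡ-+ q (k C m) (k C suc m) ⟨
  q * (k C m + k C suc m)             ≡⟨ cong (q *_) (nCk+nC[k+1]≡[n+1]C[k+1] k m) ⟩
  q * (suc k C suc m)                 ∎
  where
  open ℕ.≤-Reasoning
  with0? : Decidable₁ (λ w → w ∈ B × zero ∈ F w)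
  with0? w = (w ∈? B) ×-dec (zero ∈? F w)
  -- The condition is the size bound that the recursive call asks for. It holds whenever `zero` is
  -- not in `F w`; an overlap with `with0` is harmless, as only an upper bound on the union is
  -- wanted.
  without0? : Decidable₁ (λ w → w ∈ B × suc m ≤ ∣ tail (F w) ∣)
  without0? w = (w ∈? B) ×-dec (suc m ≤? ∣ tail (F w) ∣)
  with0 without0 : Subset n
  with0    = sieve with0?
  without0 = sieve without0?

  B⊆ : B ⊆ with0 ∪ without0
  B⊆ {w} w∈B with zero ∈? F w
  ... | yes 0∈ = x∈p∪q⁺ (inj₁ (∈-sieve⁺ with0? (w∈B , 0∈)))
  ... | no  0∉ = x∈p∪q⁺ {p = with0}
    (inj₂ (∈-sieve⁺ without0? (w∈B , ℕ.≤-trans (m≤F w∈B) (∣p∣≤∣tail∣ (F w) 0∉))))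

  bound-with : ∣ with0 ∣ ≤ q * (k C m)
  bound-with = double-counting R m k q with0 (tail ∘ F) R≤k
    (λ {w} w∈ → tail-⊆ (F w) (F⊆R (proj₁ (∈-sieve⁻ with0? w∈))))
    (λ {w} w∈ → ℕ.s≤s⁻¹ (ℕ.≤-trans (m≤F (proj₁ (∈-sieve⁻ with0? w∈))) (∣p∣≤1+∣tail∣ (F w))))
    (λ T D ∣T∣ D⊆ T⊆ → few (inside ∷ T) D (cong suc ∣T∣)
      (λ x → proj₁ (∈-sieve⁻ with0? (D⊆ x)))
      λ {w} w∈D → in∷-⊆ T (F w) (proj₂ (∈-sieve⁻ with0? (D⊆ w∈D))) (T⊆ w∈D))

  bound-without : ∣ without0 ∣ ≤ q * (k C suc m)
  bound-without = double-counting R (suc m) k q without0 (tail ∘ F) R≤k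
    (λ {w} w∈ → tail-⊆ (F w) (F⊆R (proj₁ (∈-sieve⁻ without0? w∈))))
    (λ w∈ → proj₂ (∈-sieve⁻ without0? w∈))
    (λ T D ∣T∣ D⊆ T⊆ → few (outside ∷ T) D ∣T∣
      (λ x → proj₁ (∈-sieve⁻ without0? (D⊆ x)))
      λ {w} w∈D → out∷-⊆ T (F w) (T⊆ w∈D))

-- Recursion along the rank ρ, with the function replaced on one rank at a time.
greedy : {A : Set} → A → (ρ : Fin n → ℕ) (Good : Fin n → (Fin n → A) → A → Set) →
  (∀ {v c c′ a} → (∀ u → ρ u < ρ v → c u ≡ c′ u) → Good v c a → Good v c′ a) →
  (∀ v c → ∃ (Good v c)) →
  (b : ℕ) → (∀ v → ρ v < b) → ∃[ c ] ∀ v → Good v c (c v)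
greedy {n} {A} a₀ ρ Good local extend b ρ<b = stage b , λ v → stage-good b v (ρ<b v)
  where
  stage : ℕ → Fin n → A
  -- A placeholder: by `local` only values at smaller rank matter to `Good`, and `stage j` has
  -- already set those when rank `j` is treated.
  stage zero    v = a₀
  stage (suc j) v with ρ v ℕ.≟ j
  ... | yes _ = proj₁ (extend v (stage j))
  ... | no  _ = stage j v

  stage-old : ∀ j v → ρ v < j → stage j v ≡ stage (suc j) v
  stage-old j v ρv<j with ρ v ℕ.≟ j
  ... | yes ρv≡j = contradiction ρv≡j (ℕ.<⇒≢ ρv<j)
  ... | no  _    = refl

  stage-good : ∀ j v → ρ v < j → Good v (stage j) (stage j v)
  stage-good (suc j) v ρv<1+j with ρ v ℕ.≟ j
  -- The next stage changes values at rank `j` only, hence none at a rank below that of `v`.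
  ... | yes ρv≡j = local (λ u ρu<ρv → stage-old j u (subst (ρ u <_) ρv≡j ρu<ρv))
                         (proj₂ (extend v (stage j)))
  ... | no  ρv≢j = local (λ u ρu<ρv → stage-old j u (ℕ.<-trans ρu<ρv ρv<j)) (stage-good j v ρv<j)
    where
    ρv<j : ρ v < j
    ρv<j = ℕ.≤∧≢⇒< (ℕ.s≤s⁻¹ ρv<1+j) ρv≢j

-- Bicliques and components.

module _ {n : ℕ} (G : FinGraph n) where
  open Graph G

  -- Adjacency forces `S` and `D` to be disjoint, since a common point would be a loop; this gives
  -- injectivity across the two sides.
  biclique⇒K⊑ : ∀ {s t} (S D : Subset n) → s ≤ ∣ S ∣ → t ≤ ∣ D ∣ →
    (∀ {x w} → x ∈ S → w ∈ D → x ~ w) → K s t ⊑ G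
  biclique⇒K⊑ {s} {t} S D s≤S t≤D adj with choose S s≤S | choose D t≤D
  ... | f , f-inj , f∈S | g , g-inj , g∈D = record
    { embed     = [ f , g ]′
    ; injective = λ {x} {y} → inj {x} {y}
    ; preserves = λ {x} {y} → pres {x} {y}
    }
    where
    inj : Injective _≡_ _≡_ [ f , g ]′
    inj {inj₁ i} {inj₁ j} eq = cong inj₁ (f-inj eq)
    inj {inj₁ i} {inj₂ j} eq = contradiction (adj (f∈S i) (g∈D j)) (~-irr eq)
    inj {inj₂ i} {inj₁ j} eq = contradiction (adj (f∈S j) (g∈D i)) (~-irr (sym eq))
    inj {inj₂ i} {inj₂ j} eq = cong inj₂ (g-inj eq)

    pres : ∀ {x y} → Graph._~_ (K s t) x y → [ f , g ]′ x ~ [ f , g ]′ y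
    pres {inj₁ i} {inj₂ j} _ = adj (f∈S i) (g∈D j)
    pres {inj₂ i} {inj₁ j} _ = ~-sym (adj (f∈S j) (g∈D i))

  star⇒∈ : ∀ {S u v} → v ∈ S → Star (InducedAdj G S) v u → u ∈ S
  star⇒∈ v∈S ε                    = v∈S
  star⇒∈ _   ((_ , w∈S , _) ◅ ws) = star⇒∈ w∈S ws

  component⊆ : ∀ {S X} → IsComponent G S X → X ⊆ S
  component⊆ (v , v∈S , reach) {u} u∈X = star⇒∈ v∈S (Equivalence.to (reach u) u∈X)

  -- Ranks along a total order.

  module _ {_≼_ : Rel (Fin n) 0ℓ} (total : IsTotalOrder _≡_ _≼_) where
    private
      module O = IsTotalOrder total
    open Strict _≡_ _≼_ using (<-irrefl; <-trans; <-trichotomous; <-decidable) renaming (_<_ to _≺_)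

    _≺?_ : Decidable _≺_
    _≺?_ = <-decidable _≟_ (total∧dec⇒dec O.reflexive O.antisym O.total _≟_)

    ≺-trans : ∀ {x y z} → x ≺ y → y ≺ z → x ≺ z
    ≺-trans = <-trans O.isPartialOrder

    module _ {Q : Pred (Fin n) 0ℓ} (Q? : Decidable₁ Q) where
      before? : ∀ u → Decidable₁ (λ x → Q x × x ≺ u)
      before? u x = Q? x ×-dec (x ≺? u)

      -- For `u` satisfying `Q`, the size of `before u` is the position of `u`, counted from 0,
      -- among the vertices satisfying `Q`. It is used both for the neighbours of a fixed vertex and
      -- for all vertices.
      before : Fin n → Subset n
      before u = sieve (before? u)

      rank-mono : ∀ {u u′} → Q u → u ≺ u′ → ∣ before u ∣ < ∣ before u′ ∣
      rank-mono {u} {u′} qu u≺u′ = p⊂q⇒∣p∣<∣q∣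
        ( (λ x∈ → let qx , x≺u = ∈-sieve⁻ (before? u) x∈ in
                  ∈-sieve⁺ (before? u′) (qx , ≺-trans x≺u u≺u′))
        , u , ∈-sieve⁺ (before? u′) (qu , u≺u′)
        , λ u∈ → <-irrefl refl (proj₂ (∈-sieve⁻ (before? u) u∈)))

      rank-injective : ∀ {u u′} → Q u → Q u′ → ∣ before u ∣ ≡ ∣ before u′ ∣ → u ≡ u′
      rank-injective {u} {u′} qu qu′ eq with <-trichotomous sym _≟_ O.antisym O.total u u′
      ... | tri< u≺u′ _ _ = contradiction eq (ℕ.<⇒≢ (rank-mono qu u≺u′))
      ... | tri≈ _ u≡u′ _ = u≡u′
      ... | tri> _ _ u′≺u = contradiction (sym eq) (ℕ.<⇒≢ (rank-mono qu′ u′≺u))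

    neighboursBefore : Fin n → Fin n → Subset n
    neighboursBefore w = before (w ~?_)

    -- The colour i does not occur among the first m left-neighbours of w.
    Avoids : ∀ {s} → ℕ → Fin n → Colouring n s → Fin s → Set
    Avoids m w c i = ∀ u → w ~ u → u ≺ w → c u ≡ i → m ≤ ∣ neighboursBefore w u ∣

    -- At most `m` neighbours of `w` have a position below `m`, too few to use up `suc m` colours.
    avoidable : ∀ m w (c : Colouring n (suc m)) → ∃ (Avoids m w c)
    avoidable m w c = proj₁ free , λ u w~u u≺w cu≡i →
      ℕ.≮⇒≥ λ low → proj₂ free (u , w~u , u≺w , cu≡i , low)
      where
      Used : Pred (Fin (suc m)) 0ℓ
      Used i = ∃[ u ] w ~ u × u ≺ w × c u ≡ i × ∣ neighboursBefore w u ∣ < m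

      Used? : Decidable₁ Used
      Used? i = any? λ u →
        (w ~? u) ×-dec (u ≺? w) ×-dec (c u ≟ i) ×-dec (∣ neighboursBefore w u ∣ <? m)

      -- Users of different colours have different ranks below m.
      not-all : ¬ (∀ i → Used i)
      not-all used with pigeonhole (ℕ.n<1+n m) (λ i → fromℕ< (proj₂ (proj₂ (proj₂ (proj₂ (used i))))))
      ... | i , j , i<j , eq with used i | used j
      ... | u , w~u , _ , cu≡i , low | u′ , w~u′ , _ , cu′≡j , low′ =
        <⇒≢ i<j (trans (sym cu≡i) (trans (cong c u≡u′) cu′≡j))
        where
        u≡u′ : u ≡ u′
        u≡u′ = rank-injective (w ~?_) w~u w~u′
          (trans (sym (toℕ-fromℕ< low)) (trans (cong toℕ eq) (toℕ-fromℕ< low′)))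

      free : ∃[ i ] ¬ Used i
      free = ¬∀⟶∃¬ (suc m) Used Used? not-all

    greedy-colouring : ∀ m → Σ (Colouring n (suc m)) λ c → ∀ w → Avoids m w c (c w)
    -- The rank is the position in the whole order, at most `n`, hence the bound `suc n`.
    -- `Avoids m w` consults colours of vertices before `w` only, and these have smaller rank.
    greedy-colouring m = greedy zero (λ v → ∣ before everything v ∣) (Avoids m)
      (λ same avoids u w~u u≺w c′u≡i →
        avoids u w~u u≺w (trans (same u (rank-mono everything _ u≺w)) c′u≡i))
      (avoidable m) (suc n) (λ v → s≤s (∣p∣≤n (before everything v)))
      where
      everything : Decidable₁ {A = Fin n} (λ _ → ⊤)
      everything _ = yes _

    -- Paths witnessing 2-reachability.

    ≺⇒≢ : ∀ {x y} → x ≺ y → x ≢ y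
    ≺⇒≢ = proj₂

    reach₁ : ∀ {v u} → v ~ u → u ≺ v → Reachable G _≼_ 2 v u
    reach₁ {v} {u} v~u u≺v = proj₁ u≺v , 1 , s≤s (s≤s z≤n) , v ∷ u ∷ [] ,
      ((((≺⇒≢ u≺v ∘ sym) All.∷ All.[]) AllPairs.∷ All.[] AllPairs.∷ AllPairs.[]) ,
        λ { zero → v~u }) ,
      refl , refl , λ { zero () ; (suc zero) _ (s≤s ()) }

    -- Here length 2 is needed: the interior vertex `w` of the path `v`, `w`, `u` comes after `v`.
    -- The ends of the edge from `w` to `u` differ because `v` lies strictly between them in the
    -- order.
    reach₂ : ∀ {v w u} → v ~ w → v ≺ w → w ~ u → u ≺ v → Reachable G _≼_ 2 v u
    reach₂ {v} {w} {u} v~w v≺w w~u u≺v = proj₁ u≺v , 2 , s≤s (s≤s (s≤s z≤n)) , v ∷ w ∷ u ∷ [] ,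
      (((≺⇒≢ v≺w All.∷ (≺⇒≢ u≺v ∘ sym) All.∷ All.[])
          AllPairs.∷ ((≺⇒≢ (≺-trans u≺v v≺w) ∘ sym) All.∷ All.[])
          AllPairs.∷ All.[] AllPairs.∷ AllPairs.[]) ,
        λ { zero → v~w ; (suc zero) → w~u }) ,
      refl , refl , λ { zero () ; (suc zero) _ _ → v≺w ; (suc (suc zero)) _ (s≤s (s≤s ())) }

    -- The defect bound.

    module _ {m t k : ℕ} (K-free : SubgraphFree (K (suc m) (suc t)) G)
             (bound : ∀ v → AtMost k (Reachable G _≼_ 2 v))
             (c : Colouring n (suc m)) (avoids : ∀ w → Avoids m w c (c w)) where

      monoRight? : ∀ v → Decidable₁ (λ w → v ~ w × v ≺ w × c w ≡ c v)
      monoRight? v w = (v ~? w) ×-dec (v ≺? w) ×-dec (c w ≟ c v)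

      monoRight : Fin n → Subset n
      monoRight v = sieve (monoRight? v)

      -- `T` and `v` make up `suc m` common neighbours of `D`, so `suc t` elements of `D` would
      -- complete a forbidden biclique.
      few-common : ∀ v (T D : Subset n) → ∣ T ∣ ≡ m → D ⊆ monoRight v →
        (∀ {w} → w ∈ D → T ⊆ neighboursBefore w v) → ∣ D ∣ ≤ t
      few-common v T D ∣T∣≡m D⊆ T⊆ = ℕ.≮⇒≥ λ t<D → K-free
        (biclique⇒K⊑ (T ∪ ⁅ v ⁆) D (large t<D) t<D adj)
        where
        v∉T : ∀ {w} → w ∈ D → ¬ (v ∈ T)
        v∉T {w} w∈D v∈T = <-irrefl refl (proj₂ (∈-sieve⁻ (before? (w ~?_) v) (T⊆ w∈D v∈T)))

        -- `t < ∣ D ∣` supplies an element `w` of `D`; then `T` consists of vertices before `v`, so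
        -- adding `v` really enlarges it.
        large : t < ∣ D ∣ → m < ∣ T ∪ ⁅ v ⁆ ∣
        large t<D with choose D t<D
        ... | f , _ , f∈D = subst (_< _) ∣T∣≡m (p⊂q⇒∣p∣<∣q∣
          (p⊆p∪q ⁅ v ⁆ , v , q⊆p∪q T ⁅ v ⁆ (x∈⁅x⁆ v) , v∉T (f∈D zero)))

        adj : ∀ {x w} → x ∈ T ∪ ⁅ v ⁆ → w ∈ D → x ~ w
        adj {x} {w} x∈ w∈D with x∈p∪q⁻ T ⁅ v ⁆ x∈
        ... | inj₁ x∈T = ~-sym (proj₁ (∈-sieve⁻ (before? (w ~?_) v) (T⊆ w∈D x∈T)))
        ... | inj₂ x∈v rewrite x∈⁅y⁆⇒x≡y v x∈v = proj₁ (∈-sieve⁻ (monoRight? v) (D⊆ w∈D))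

      -- Each `w` counted here has its neighbours before `v` inside the one set `R` of vertices
      -- reachable from `v`, so sets of `m` of them can be counted within `R`.
      ∣monoRight∣≤ : ∀ v → ∣ monoRight v ∣ ≤ t * (k C m)
      ∣monoRight∣≤ v with bound v
      ... | R , ∣R∣≤k , reach∈R =
        double-counting R m k t (monoRight v) (λ w → neighboursBefore w v) ∣R∣≤k
          (λ {w} w∈ {x} x∈ →
            let v~w , v≺w , _ = ∈-sieve⁻ (monoRight? v) w∈
                w~x , x≺v     = ∈-sieve⁻ (before? (w ~?_) v) x∈
            in reach∈R x (reach₂ v~w v≺w w~x x≺v))
          -- As `v` is a left-neighbour of `w` with the colour of `w`, it is not among the first
          -- `m`, so at least `m` neighbours of `w` precede it.
          (λ {w} w∈ →
            let v~w , v≺w , cw≡cv = ∈-sieve⁻ (monoRight? v) w∈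
            in avoids w v (~-sym v~w) v≺w (sym cw≡cv))
          (few-common v)

      defect-bound : HasDefect G c (k + t * (k C m))
      defect-bound i X comp v v∈X with bound v
      ... | R , ∣R∣≤k , reach∈R = begin
        ∣ neighbours G v ∩ X ∣      ≤⟨ p⊆q⇒∣p∣≤∣q∣ covered ⟩
        ∣ R ∪ monoRight v ∣         ≤⟨ ∣p∪q∣≤∣p∣+∣q∣ R (monoRight v) ⟩
        ∣ R ∣ + ∣ monoRight v ∣     ≤⟨ ℕ.+-mono-≤ ∣R∣≤k (∣monoRight∣≤ v) ⟩
        k + t * (k C m)             ∎
        where
        open ℕ.≤-Reasoning
        coloured : ∀ {u} → u ∈ X → c u ≡ i
        -- `colourClass c i` and `neighbours G v` both unfold to a `sieve`, so `∈-sieve⁻` applies to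
        -- them directly.
        coloured u∈X = ∈-sieve⁻ (λ u → c u ≟ i) (component⊆ comp u∈X)

        covered : neighbours G v ∩ X ⊆ R ∪ monoRight v
        covered {u} u∈ with x∈p∩q⁻ (neighbours G v) X u∈
        ... | u∈N , u∈X with ∈-sieve⁻ (v ~?_) u∈N | <-trichotomous sym _≟_ O.antisym O.total u v
        ... | v~u | tri< u≺v _ _ = x∈p∪q⁺ (inj₁ (reach∈R u (reach₁ v~u u≺v)))
        ... | v~u | tri≈ _ u≡v _ = contradiction v~u (~-irr (sym u≡v))
        ... | v~u | tri> _ _ v≺u = x∈p∪q⁺ {p = R} (inj₂ (∈-sieve⁺ (monoRight? v)
          (v~u , v≺u , trans (coloured u∈X) (sym (coloured v∈X)))))

theorem17 : ∀ (s t : ℕ) → 1 ≤ s → 1 ≤ t →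
    ∀ (n : ℕ) (G : FinGraph n) → SubgraphFree (K s t) G →
    Σ (Colouring n s) λ c → HasDefect G c (col 2 G + (t ∸ 1) * (col 2 G C (s ∸ 1)))
-- With successors in place of `s` and `t`, the truncated subtractions in the bound compute to `m`
-- and `t`. The order matched on attains `col 2 G`.
theorem17 (suc m) (suc t) _ _ n G K-free with proj₁ (proj₂ (col-exists 2 G))
... | _ , total , bound =
  let c , avoids = greedy-colouring G total m
  in c , defect-bound G total K-free bound c avoids
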